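{- Let $\mathbb{A}$ be a symmetric strict monoidal category and let $\mathbf{H}\,\mathcal{C}(\mathbb{A})$ be the strict monoidal category of horizontal cells of its free cornering. For any objects $A,B$ of $\mathbb{A}$, the following isomorphisms exist in $\mathbf{H}\,\mathcal{C}(\mathbb{A})$: 1. $I^\circ\cong I\cong I^\bullet$; 2. $A^\circ\otimes B^\circ\cong B^\circ\otimes A^\circ$ and $A^\bullet\otimes B^\bullet\cong B^\bullet\otimes A^\bullet$; 3. $(A\otimes B)^\circ\cong A^\circ\otimes B^\circ$ and $(A\otimes B)^\bullet\cong A^\bullet\otimes B^\bullet$. (In 1, $I^\circ$ and $I^\bullet$ are the generators associated with the unit object of $\mathbb{A}$, and the middle $I$ is the monoidal unit of $\mathbf{H}\,\mathcal{C}(\mathbb{A})$, i.e. the empty word.)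
   Context: Single-object double categories. A single-object double category $\mathbb{D}$ consists of a monoid $(\mathbb{D}_H,\otimes,I)$ of horizontal edges, a monoid $(\mathbb{D}_V,\otimes,I)$ of vertical edges, and cells $\alpha$, each with a top and a bottom boundary in $\mathbb{D}_H$ and a left and a right boundary in $\mathbb{D}_V$. If the right boundary of $\alpha$ equals the left boundary of $\beta$ there is a horizontal composite $\alpha\vert\beta$ (top/bottom boundaries are multiplied in the order $\alpha,\beta$; left boundary that of $\alpha$, right boundary that of $\beta$). If the bottom boundary of $\alpha$ equals the top boundary of $\beta$ there is a vertical composite $\frac{\alpha}{\beta}$ (left/right boundaries multiplied in the order $\alpha,\beta$; top that of $\alpha$, bottom that of $\beta$). Both compositions are associative and unital, with identity cells $1_A$ for $A\in\mathbb{D}_H$ (top $=$ bottom $=A$, left $=$ right $=I$; identities for vertical composition) and $1_X$ for $X\in\mathbb{D}_V$ (left $=$ right $=X$, top $=$ bottom $=I$; identities for horizontal composition), with $1_A\vert 1_B=1_{A\otimes B}$, $\frac{1_X}{1_Y}=1_{X\otimes Y}$, the two identity cells on $I$ coincide, and the interchange law $\frac{\alpha}{\beta}\big\vert\frac{\gamma}{\delta}=\frac{\alpha\vert\gamma}{\beta\vert\delta}$ holds. Horizontal cells. $\mathbf{H}\mathbb{D}$ is the strict monoidal category with object set $\mathbb{D}_V$, whose morphisms $X\to Y$ are cells with left boundary $X$, right boundary $Y$ and top and bottom boundary $I$; composition is horizontal composition, and the tensor product is vertical composition, $h\otimes k=\frac{h}{k}$. Free cornering. For a symmetric strict monoidal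 category $\mathbb{A}$ (with object set $\mathbb{A}_0$), $\mathcal{C}(\mathbb{A})$ is the free single-object double category determined by: horizontal edge monoid $(\mathbb{A}_0,\otimes,I)$; vertical edge monoid the free monoid $\mathbb{A}^{\circ\bullet}=(\mathbb{A}_0\times\{\circ,\bullet\})^*$, with generators written $A^\circ$, $A^\bullet$, product written $\otimes$ and unit $I$; generating cells, for each $A\in\mathbb{A}_0$, the corners (boundaries not mentioned are $I$) - $s^\circ_A$: top $A$, right $A^\circ$; $\quad r^\circ_A$: left $A^\circ$, bottom $A$; - $s^\bullet_A$: top $A$, left $A^\bullet$; $\quad r^\bullet_A$: right $A^\bullet$, bottom $A$; and, for each morphism $f:A\to B$ of $\mathbb{A}$, a cell $\ulcorner f\urcorner$ with top $A$, bottom $B$; subject to the yanking equations $s^\circ_A\vert r^\circ_A=1_A$, $\frac{r^\circ_A}{s^\circ_A}=1_{A^\circ}$, $r^\bullet_A\vert s^\bullet_A=1_A$, $\frac{r^\bullet_A}{s^\bullet_A}=1_{A^\bullet}$, and the equations $\frac{\ulcorner f\urcorner}{\ulcorner g\urcorner}=\ulcorner f;g\urcorner$ (for composable $f,g$; $f;g$ is "first $f$ then $g$"), $\ulcorner 1_A\urcorner=1_A$, $\ulcorner f\urcorner\vert\ulcorner g\urcorner=\ulcorner f\otimes g\urcorner$. -}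

module Defs where

open import Level using (Level; suc; _⊔_)
open import Algebra.Structures using (IsMonoid)
open import Data.List using (List; []; _∷_; [_]; _++_)
open import Data.List.Properties using (++-isMonoid)
open import Data.Product using (_×_; _,_)
open import Relation.Binary.Core using (Rel)
open import Relation.Binary.Structures using (IsEquivalence)
open import Relation.Binary.PropositionalEquality
  using (_≡_; refl; sym; trans; cong₂; subst; subst₂)

-- The strictness laws hold between morphisms (or cells) whose boundaries are
-- equal only propositionally.  The relations HetHom and HetCell say that the
-- boundaries coincide and, along that identification, the two sides are
-- related by _≈_.

data HetHom {o ℓ e} {Obj : Set o} {Hom : Obj → Obj → Set ℓ}
            (_≈_ : ∀ {A B} → Rel (Hom A B) e)
            {A B : Obj} (f : Hom A B) :
            ∀ {A′ B′} → Hom A′ B′ → Set (ℓ ⊔ e) where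
  het : {g : Hom A B} → f ≈ g → HetHom _≈_ f g

data HetCell {h v c e} {H : Set h} {V : Set v} {Cell : H → H → V → V → Set c}
             (_≈_ : ∀ {A B X Y} → Rel (Cell A B X Y) e)
             {A B : H} {X Y : V} (α : Cell A B X Y) :
             ∀ {A′ B′ X′ Y′} → Cell A′ B′ X′ Y′ → Set (c ⊔ e) where
  het : {β : Cell A B X Y} → α ≈ β → HetCell _≈_ α β

record StrictMonoidalCategory (o ℓ e : Level) : Set (suc (o ⊔ ℓ ⊔ e)) where
  infix  4 _≈_ _≋_
  infixr 6 _⨾_
  infixr 7 _⊗_ _⊗₁_
  field
    Obj : Set o
    Hom : Obj → Obj → Set ℓ
    _≈_ : ∀ {A B} → Rel (Hom A B) e
    id  : ∀ {A} → Hom A A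
    -- diagrammatic order: f ⨾ g is "first f then g"
    _⨾_ : ∀ {A B C} → Hom A B → Hom B C → Hom A C

    ≈-isEquivalence : ∀ {A B} → IsEquivalence (_≈_ {A} {B})
    ⨾-cong  : ∀ {A B C} {f f′ : Hom A B} {g g′ : Hom B C} →
              f ≈ f′ → g ≈ g′ → f ⨾ g ≈ f′ ⨾ g′
    ⨾-assoc : ∀ {A B C D} (f : Hom A B) (g : Hom B C) (h : Hom C D) →
              (f ⨾ g) ⨾ h ≈ f ⨾ (g ⨾ h)
    ⨾-idˡ   : ∀ {A B} (f : Hom A B) → id ⨾ f ≈ f
    ⨾-idʳ   : ∀ {A B} (f : Hom A B) → f ⨾ id ≈ f

    _⊗_  : Obj → Obj → Obj
    unit : Obj
    ⊗-isMonoid : IsMonoid _≡_ _⊗_ unit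
    _⊗₁_ : ∀ {A B C D} → Hom A B → Hom C D → Hom (A ⊗ C) (B ⊗ D)
    ⊗₁-cong : ∀ {A B C D} {f f′ : Hom A B} {g g′ : Hom C D} →
              f ≈ f′ → g ≈ g′ → f ⊗₁ g ≈ f′ ⊗₁ g′
    ⊗₁-id   : ∀ {A B} → id {A} ⊗₁ id {B} ≈ id
    ⊗₁-⨾    : ∀ {A B C A′ B′ C′}
              (f : Hom A B) (g : Hom B C) (f′ : Hom A′ B′) (g′ : Hom B′ C′) →
              (f ⨾ g) ⊗₁ (f′ ⨾ g′) ≈ (f ⊗₁ f′) ⨾ (g ⊗₁ g′)

  _≋_ : ∀ {A B A′ B′} → Hom A B → Hom A′ B′ → Set (ℓ ⊔ e)
  f ≋ g = HetHom {Hom = Hom} _≈_ f g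

  field
    ⊗₁-assoc : ∀ {A A′ B B′ C C′} (f : Hom A A′) (g : Hom B B′) (h : Hom C C′) →
               (f ⊗₁ g) ⊗₁ h ≋ f ⊗₁ (g ⊗₁ h)
    ⊗₁-unitˡ : ∀ {A B} (f : Hom A B) → id {unit} ⊗₁ f ≋ f
    ⊗₁-unitʳ : ∀ {A B} (f : Hom A B) → f ⊗₁ id {unit} ≋ f

  -- the identity morphism, regarded as a morphism between equal objects
  idAlong : ∀ {A B} → A ≡ B → Hom A B
  idAlong {A} p = subst (Hom A) p id

  infix 4 _≅_
  record _≅_ (A B : Obj) : Set (ℓ ⊔ e) where
    field
      from : Hom A B
      to   : Hom B A
      from⨾to : from ⨾ to ≈ id
      to⨾from : to ⨾ from ≈ id

record SymmetricStrictMonoidalCategory (o ℓ e : Level) : Set (suc (o ⊔ ℓ ⊔ e)) where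
  field
    strictMonoidalCategory : StrictMonoidalCategory o ℓ e
  open StrictMonoidalCategory strictMonoidalCategory public
  field
    σ : ∀ A B → Hom (A ⊗ B) (B ⊗ A)
    σ-natural : ∀ {A A′ B B′} (f : Hom A A′) (g : Hom B B′) →
                (f ⊗₁ g) ⨾ σ A′ B′ ≈ σ A B ⨾ (g ⊗₁ f)
    σ-involutive : ∀ A B → σ A B ⨾ σ B A ≈ id
    -- The other hexagon follows from this one and σ-involutive.
    σ-hexagon : ∀ A B C →
                σ A (B ⊗ C) ≋
                (σ A B ⊗₁ id {C}) ⨾ idAlong (IsMonoid.assoc ⊗-isMonoid B A C)
                                  ⨾ (id {B} ⊗₁ σ A C)

record SingleObjectDoubleCategory (h v c e : Level) : Set (suc (h ⊔ v ⊔ c ⊔ e)) where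
  infix  4 _≈_ _≋_
  infixr 6 _∣_
  infixr 7 _⁄_
  infixr 8 _⊗ₕ_ _⊗ᵥ_
  field
    Horizontal   : Set h
    _⊗ₕ_         : Horizontal → Horizontal → Horizontal
    Iₕ           : Horizontal
    ⊗ₕ-isMonoid  : IsMonoid _≡_ _⊗ₕ_ Iₕ

    Vertical     : Set v
    _⊗ᵥ_         : Vertical → Vertical → Vertical
    Iᵥ           : Vertical
    ⊗ᵥ-isMonoid  : IsMonoid _≡_ _⊗ᵥ_ Iᵥ

    -- Cell top bottom left right
    Cell : Horizontal → Horizontal → Vertical → Vertical → Set c
    _≈_  : ∀ {A B X Y} → Rel (Cell A B X Y) e
    ≈-isEquivalence : ∀ {A B X Y} → IsEquivalence (_≈_ {A} {B} {X} {Y})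

    -- α ∣ β is the horizontal composite; α ⁄ β is the vertical one, α above β.
    _∣_ : ∀ {A B A′ B′ X Y Z} → Cell A B X Y → Cell A′ B′ Y Z →
          Cell (A ⊗ₕ A′) (B ⊗ₕ B′) X Z
    _⁄_ : ∀ {A B C X Y X′ Y′} → Cell A B X Y → Cell B C X′ Y′ →
          Cell A C (X ⊗ᵥ X′) (Y ⊗ᵥ Y′)
    1ₕ  : ∀ A → Cell A A Iᵥ Iᵥ
    1ᵥ  : ∀ X → Cell Iₕ Iₕ X X

    ∣-cong : ∀ {A B A′ B′ X Y Z} {α α′ : Cell A B X Y} {β β′ : Cell A′ B′ Y Z} →
             α ≈ α′ → β ≈ β′ → α ∣ β ≈ α′ ∣ β′
    ⁄-cong : ∀ {A B C X Y X′ Y′} {α α′ : Cell A B X Y} {β β′ : Cell B C X′ Y′} →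
             α ≈ α′ → β ≈ β′ → α ⁄ β ≈ α′ ⁄ β′

  _≋_ : ∀ {A B X Y A′ B′ X′ Y′} → Cell A B X Y → Cell A′ B′ X′ Y′ → Set (c ⊔ e)
  α ≋ β = HetCell {Cell = Cell} _≈_ α β

  field
    ∣-assoc : ∀ {A B A′ B′ A″ B″ X Y Z W}
              (α : Cell A B X Y) (β : Cell A′ B′ Y Z) (γ : Cell A″ B″ Z W) →
              (α ∣ β) ∣ γ ≋ α ∣ (β ∣ γ)
    ∣-idˡ   : ∀ {A B X Y} (α : Cell A B X Y) → 1ᵥ X ∣ α ≋ α
    ∣-idʳ   : ∀ {A B X Y} (α : Cell A B X Y) → α ∣ 1ᵥ Y ≋ α
    ⁄-assoc : ∀ {A B C D X Y X′ Y′ X″ Y″}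
              (α : Cell A B X Y) (β : Cell B C X′ Y′) (γ : Cell C D X″ Y″) →
              (α ⁄ β) ⁄ γ ≋ α ⁄ (β ⁄ γ)
    ⁄-idˡ   : ∀ {A B X Y} (α : Cell A B X Y) → 1ₕ A ⁄ α ≋ α
    ⁄-idʳ   : ∀ {A B X Y} (α : Cell A B X Y) → α ⁄ 1ₕ B ≋ α
    1ₕ-∣    : ∀ A B → 1ₕ A ∣ 1ₕ B ≈ 1ₕ (A ⊗ₕ B)
    1ᵥ-⁄    : ∀ X Y → 1ᵥ X ⁄ 1ᵥ Y ≈ 1ᵥ (X ⊗ᵥ Y)
    1ₕ≈1ᵥ   : 1ₕ Iₕ ≈ 1ᵥ Iᵥ
    interchange : ∀ {A B C A′ B′ C′ X Y Z X′ Y′ Z′}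
                  (α : Cell A B X Y) (β : Cell B C X′ Y′)
                  (γ : Cell A′ B′ Y Z) (δ : Cell B′ C′ Y′ Z′) →
                  (α ⁄ β) ∣ (γ ⁄ δ) ≈ (α ∣ γ) ⁄ (β ∣ δ)

module HorizontalCells {h v c e} (𝔻 : SingleObjectDoubleCategory h v c e) where
  open SingleObjectDoubleCategory 𝔻

  private
    I⊗I≡I : Iₕ ⊗ₕ Iₕ ≡ Iₕ
    I⊗I≡I = IsMonoid.identityˡ ⊗ₕ-isMonoid Iₕ

    module E {A B X Y} = IsEquivalence (≈-isEquivalence {A} {B} {X} {Y})

  HCell : Vertical → Vertical → Set c
  HCell X Y = Cell Iₕ Iₕ X Y

  -- A horizontal composite of horizontal cells has top and bottom Iₕ ⊗ₕ Iₕ,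
  -- which has to be identified with Iₕ.
  infixr 6 _⨾ₕ_
  _⨾ₕ_ : ∀ {X Y Z} → HCell X Y → HCell Y Z → HCell X Z
  _⨾ₕ_ {X} {Y} {Z} α β = subst₂ (λ A B → Cell A B X Z) I⊗I≡I I⊗I≡I (α ∣ β)

  ≋-refl : ∀ {A B X Y} {α : Cell A B X Y} → α ≋ α
  ≋-refl = het E.refl

  ≋-sym : ∀ {A B X Y A′ B′ X′ Y′} {α : Cell A B X Y} {β : Cell A′ B′ X′ Y′} →
          α ≋ β → β ≋ α
  ≋-sym (het p) = het (E.sym p)

  ≋-trans : ∀ {A B X Y A′ B′ X′ Y′ A″ B″ X″ Y″}
            {α : Cell A B X Y} {β : Cell A′ B′ X′ Y′} {γ : Cell A″ B″ X″ Y″} →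
            α ≋ β → β ≋ γ → α ≋ γ
  ≋-trans (het p) (het q) = het (E.trans p q)

  ≋⇒≈ : ∀ {A B X Y} {α β : Cell A B X Y} → α ≋ β → α ≈ β
  ≋⇒≈ (het p) = p

  ≋⇒hom : ∀ {X Y X′ Y′} {α : HCell X Y} {β : HCell X′ Y′} →
          α ≋ β → HetHom {Hom = HCell} _≈_ α β
  ≋⇒hom (het p) = het p

  ∣-cong≋ : ∀ {A B C D X Y Z A′ B′ C′ D′ X′ Y′ Z′}
            {α : Cell A B X Y} {α′ : Cell A′ B′ X′ Y′}
            {β : Cell C D Y Z} {β′ : Cell C′ D′ Y′ Z′} →
            α ≋ α′ → β ≋ β′ → α ∣ β ≋ α′ ∣ β′
  ∣-cong≋ (het p) (het q) = het (∣-cong p q)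

  ⁄-cong≋ : ∀ {A B C X Y X₁ Y₁ A′ B′ C′ X′ Y′ X₁′ Y₁′}
            {α : Cell A B X Y} {α′ : Cell A′ B′ X′ Y′}
            {β : Cell B C X₁ Y₁} {β′ : Cell B′ C′ X₁′ Y₁′} →
            α ≋ α′ → β ≋ β′ → α ⁄ β ≋ α′ ⁄ β′
  ⁄-cong≋ (het p) (het q) = het (⁄-cong p q)

  subst₂-≋ : ∀ {A B A′ B′ X Y} (p : A ≡ A′) (q : B ≡ B′) (α : Cell A B X Y) →
             subst₂ (λ A B → Cell A B X Y) p q α ≋ α
  subst₂-≋ refl refl α = ≋-refl

  ⨾ₕ≋∣ : ∀ {X Y Z} (α : HCell X Y) (β : HCell Y Z) → α ⨾ₕ β ≋ α ∣ β
  ⨾ₕ≋∣ α β = subst₂-≋ I⊗I≡I I⊗I≡I (α ∣ β)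

  𝐇 : StrictMonoidalCategory v c e
  𝐇 = record
    { Obj = Vertical
    ; Hom = HCell
    ; _≈_ = _≈_
    ; id  = λ {X} → 1ᵥ X
    ; _⨾_ = _⨾ₕ_
    ; ≈-isEquivalence = ≈-isEquivalence
    ; ⨾-cong = λ {_} {_} {_} {f} {f′} {g} {g′} p q →
        ≋⇒≈ (≋-trans (⨾ₕ≋∣ f g)
            (≋-trans (het (∣-cong p q)) (≋-sym (⨾ₕ≋∣ f′ g′))))
    ; ⨾-assoc = λ f g h →
        ≋⇒≈ (≋-trans (⨾ₕ≋∣ (f ⨾ₕ g) h)
            (≋-trans (∣-cong≋ (⨾ₕ≋∣ f g) ≋-refl)
            (≋-trans (∣-assoc f g h)
            (≋-trans (∣-cong≋ ≋-refl (≋-sym (⨾ₕ≋∣ g h)))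
                     (≋-sym (⨾ₕ≋∣ f (g ⨾ₕ h)))))))
    ; ⨾-idˡ = λ f → ≋⇒≈ (≋-trans (⨾ₕ≋∣ (1ᵥ _) f) (∣-idˡ f))
    ; ⨾-idʳ = λ f → ≋⇒≈ (≋-trans (⨾ₕ≋∣ f (1ᵥ _)) (∣-idʳ f))
    ; _⊗_  = _⊗ᵥ_
    ; unit = Iᵥ
    ; ⊗-isMonoid = ⊗ᵥ-isMonoid
    ; _⊗₁_ = _⁄_
    ; ⊗₁-cong = ⁄-cong
    ; ⊗₁-id = 1ᵥ-⁄ _ _
    ; ⊗₁-⨾ = λ f g f′ g′ →
        ≋⇒≈ (≋-trans (⁄-cong≋ (⨾ₕ≋∣ f g) (⨾ₕ≋∣ f′ g′))
            (≋-trans (het (E.sym (interchange f f′ g g′)))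
                     (≋-sym (⨾ₕ≋∣ (f ⁄ f′) (g ⁄ g′)))))
    ; ⊗₁-assoc = λ f g h → ≋⇒hom (⁄-assoc f g h)
    ; ⊗₁-unitˡ = λ f →
        ≋⇒hom (≋-trans (⁄-cong≋ (het (E.sym 1ₕ≈1ᵥ)) ≋-refl) (⁄-idˡ f))
    ; ⊗₁-unitʳ = λ f →
        ≋⇒hom (≋-trans (⁄-cong≋ ≋-refl (het (E.sym 1ₕ≈1ᵥ))) (⁄-idʳ f))
    }

open HorizontalCells using (𝐇) public

data Polarity : Set where
  ○ ● : Polarity

module FreeCornering {o ℓ e} (𝔸 : SymmetricStrictMonoidalCategory o ℓ e) where
  open SymmetricStrictMonoidalCategory 𝔸 using (Obj; Hom; _⊗_; unit; ⊗-isMonoid)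
  private module A = SymmetricStrictMonoidalCategory 𝔸

  Word : Set o
  Word = List (Obj × Polarity)

  infix 9 _° _•
  _° _• : Obj → Word
  A ° = [ A , ○ ]
  A • = [ A , ● ]

  infixr 6 _∣_
  infixr 7 _⁄_

  -- Cell terms, indexed by top, bottom, left and right boundary.
  data Cell : Obj → Obj → Word → Word → Set (o ⊔ ℓ) where
    s° : ∀ A → Cell A unit [] (A °)
    r° : ∀ A → Cell unit A (A °) []
    s• : ∀ A → Cell A unit (A •) []
    r• : ∀ A → Cell unit A [] (A •)
    ⌜_⌝ : ∀ {A B} → Hom A B → Cell A B [] []
    1ₕ  : ∀ A → Cell A A [] []
    1ᵥ  : ∀ X → Cell unit unit X X
    _∣_ : ∀ {A B A′ B′ X Y Z} → Cell A B X Y → Cell A′ B′ Y Z →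
          Cell (A ⊗ A′) (B ⊗ B′) X Z
    _⁄_ : ∀ {A B C X Y X′ Y′} → Cell A B X Y → Cell B C X′ Y′ →
          Cell A C (X ++ X′) (Y ++ Y′)

  -- The least congruence containing the double category laws and the equations
  -- on generators.  It relates terms of different boundary types because the
  -- two sides of a law have boundaries that are only propositionally equal;
  -- ∼-boundaries shows that related terms always have equal boundaries.
  infix 4 _∼_
  data _∼_ : ∀ {A B X Y A′ B′ X′ Y′} →
             Cell A B X Y → Cell A′ B′ X′ Y′ → Set (o ⊔ ℓ ⊔ e) where
    ∼-refl  : ∀ {A B X Y} {α : Cell A B X Y} → α ∼ α
    ∼-sym   : ∀ {A B X Y A′ B′ X′ Y′} {α : Cell A B X Y} {β : Cell A′ B′ X′ Y′} →
              α ∼ β → β ∼ α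
    ∼-trans : ∀ {A B X Y A′ B′ X′ Y′ A″ B″ X″ Y″}
              {α : Cell A B X Y} {β : Cell A′ B′ X′ Y′} {γ : Cell A″ B″ X″ Y″} →
              α ∼ β → β ∼ γ → α ∼ γ
    ∣-cong  : ∀ {A B C D X Y Z A′ B′ C′ D′ X′ Y′ Z′}
              {α : Cell A B X Y} {α′ : Cell A′ B′ X′ Y′}
              {β : Cell C D Y Z} {β′ : Cell C′ D′ Y′ Z′} →
              α ∼ α′ → β ∼ β′ → α ∣ β ∼ α′ ∣ β′
    ⁄-cong  : ∀ {A B C X Y Z W A′ B′ C′ X′ Y′ Z′ W′}
              {α : Cell A B X Y} {α′ : Cell A′ B′ X′ Y′}
              {β : Cell B C Z W} {β′ : Cell B′ C′ Z′ W′} →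
              α ∼ α′ → β ∼ β′ → α ⁄ β ∼ α′ ⁄ β′

    ∣-assoc : ∀ {A B A′ B′ A″ B″ X Y Z W}
              (α : Cell A B X Y) (β : Cell A′ B′ Y Z) (γ : Cell A″ B″ Z W) →
              (α ∣ β) ∣ γ ∼ α ∣ (β ∣ γ)
    ∣-idˡ   : ∀ {A B X Y} (α : Cell A B X Y) → 1ᵥ X ∣ α ∼ α
    ∣-idʳ   : ∀ {A B X Y} (α : Cell A B X Y) → α ∣ 1ᵥ Y ∼ α
    ⁄-assoc : ∀ {A B C D X Y X′ Y′ X″ Y″}
              (α : Cell A B X Y) (β : Cell B C X′ Y′) (γ : Cell C D X″ Y″) →
              (α ⁄ β) ⁄ γ ∼ α ⁄ (β ⁄ γ)
    ⁄-idˡ   : ∀ {A B X Y} (α : Cell A B X Y) → 1ₕ A ⁄ α ∼ α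
    ⁄-idʳ   : ∀ {A B X Y} (α : Cell A B X Y) → α ⁄ 1ₕ B ∼ α
    1ₕ-∣    : ∀ A B → 1ₕ A ∣ 1ₕ B ∼ 1ₕ (A ⊗ B)
    1ᵥ-⁄    : ∀ X Y → 1ᵥ X ⁄ 1ᵥ Y ∼ 1ᵥ (X ++ Y)
    1ₕ∼1ᵥ   : 1ₕ unit ∼ 1ᵥ []
    interchange : ∀ {A B C A′ B′ C′ X Y Z X′ Y′ Z′}
                  (α : Cell A B X Y) (β : Cell B C X′ Y′)
                  (γ : Cell A′ B′ Y Z) (δ : Cell B′ C′ Y′ Z′) →
                  (α ⁄ β) ∣ (γ ⁄ δ) ∼ (α ∣ γ) ⁄ (β ∣ δ)

    yank°-∣ : ∀ A → s° A ∣ r° A ∼ 1ₕ A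
    yank°-⁄ : ∀ A → r° A ⁄ s° A ∼ 1ᵥ (A °)
    yank•-∣ : ∀ A → r• A ∣ s• A ∼ 1ₕ A
    yank•-⁄ : ∀ A → r• A ⁄ s• A ∼ 1ᵥ (A •)

    ⌜⌝-cong : ∀ {A B} {f g : Hom A B} → f A.≈ g → ⌜ f ⌝ ∼ ⌜ g ⌝
    ⌜⌝-⨾    : ∀ {A B C} (f : Hom A B) (g : Hom B C) → ⌜ f ⌝ ⁄ ⌜ g ⌝ ∼ ⌜ f A.⨾ g ⌝
    ⌜⌝-id   : ∀ A → ⌜ A.id {A} ⌝ ∼ 1ₕ A
    ⌜⌝-⊗    : ∀ {A B C D} (f : Hom A B) (g : Hom C D) → ⌜ f ⌝ ∣ ⌜ g ⌝ ∼ ⌜ f A.⊗₁ g ⌝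

  private
    module M = IsMonoid ⊗-isMonoid
    module W = IsMonoid (++-isMonoid {A = Obj × Polarity})

  ∼-boundaries : ∀ {A B X Y A′ B′ X′ Y′}
                 {α : Cell A B X Y} {β : Cell A′ B′ X′ Y′} → α ∼ β →
                 (A ≡ A′) × (B ≡ B′) × (X ≡ X′) × (Y ≡ Y′)
  ∼-boundaries ∼-refl = refl , refl , refl , refl
  ∼-boundaries (∼-sym p) with ∼-boundaries p
  ... | a , b , x , y = sym a , sym b , sym x , sym y
  ∼-boundaries (∼-trans p q) with ∼-boundaries p | ∼-boundaries q
  ... | a , b , x , y | a′ , b′ , x′ , y′ =
    trans a a′ , trans b b′ , trans x x′ , trans y y′
  ∼-boundaries (∣-cong p q) with ∼-boundaries p | ∼-boundaries q
  ... | a , b , x , _ | a′ , b′ , _ , z = cong₂ _⊗_ a a′ , cong₂ _⊗_ b b′ , x , z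
  ∼-boundaries (⁄-cong p q) with ∼-boundaries p | ∼-boundaries q
  ... | a , _ , x , y | _ , c , x′ , y′ = a , c , cong₂ _++_ x x′ , cong₂ _++_ y y′
  ∼-boundaries (∣-assoc _ _ _) = M.assoc _ _ _ , M.assoc _ _ _ , refl , refl
  ∼-boundaries (∣-idˡ _) = M.identityˡ _ , M.identityˡ _ , refl , refl
  ∼-boundaries (∣-idʳ _) = M.identityʳ _ , M.identityʳ _ , refl , refl
  ∼-boundaries (⁄-assoc {X = X} {Y} {X′} {Y′} {X″} {Y″} _ _ _) =
    refl , refl , W.assoc X X′ X″ , W.assoc Y Y′ Y″
  ∼-boundaries (⁄-idˡ _) = refl , refl , refl , refl
  ∼-boundaries (⁄-idʳ _) = refl , refl , W.identityʳ _ , W.identityʳ _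
  ∼-boundaries (1ₕ-∣ _ _) = refl , refl , refl , refl
  ∼-boundaries (1ᵥ-⁄ _ _) = refl , refl , refl , refl
  ∼-boundaries 1ₕ∼1ᵥ = refl , refl , refl , refl
  ∼-boundaries (interchange _ _ _ _) = refl , refl , refl , refl
  ∼-boundaries (yank°-∣ _) = M.identityʳ _ , M.identityˡ _ , refl , refl
  ∼-boundaries (yank°-⁄ _) = refl , refl , refl , refl
  ∼-boundaries (yank•-∣ _) = M.identityˡ _ , M.identityʳ _ , refl , refl
  ∼-boundaries (yank•-⁄ _) = refl , refl , refl , refl
  ∼-boundaries (⌜⌝-cong _) = refl , refl , refl , refl
  ∼-boundaries (⌜⌝-⨾ _ _) = refl , refl , refl , refl
  ∼-boundaries (⌜⌝-id _) = refl , refl , refl , refl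
  ∼-boundaries (⌜⌝-⊗ _ _) = refl , refl , refl , refl

  ∼⇒het : ∀ {A B X Y A′ B′ X′ Y′} {α : Cell A B X Y} {β : Cell A′ B′ X′ Y′} →
          α ∼ β → HetCell {Cell = Cell} _∼_ α β
  ∼⇒het p with ∼-boundaries p
  ... | refl , refl , refl , refl = het p

  𝓒 : SingleObjectDoubleCategory o o (o ⊔ ℓ) (o ⊔ ℓ ⊔ e)
  𝓒 = record
    { Horizontal  = Obj
    ; _⊗ₕ_        = _⊗_
    ; Iₕ          = unit
    ; ⊗ₕ-isMonoid = ⊗-isMonoid
    ; Vertical    = Word
    ; _⊗ᵥ_        = _++_
    ; Iᵥ          = []
    ; ⊗ᵥ-isMonoid = ++-isMonoid
    ; Cell = Cell
    ; _≈_  = _∼_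
    ; ≈-isEquivalence = record { refl = ∼-refl ; sym = ∼-sym ; trans = ∼-trans }
    ; _∣_ = _∣_
    ; _⁄_ = _⁄_
    ; 1ₕ  = 1ₕ
    ; 1ᵥ  = 1ᵥ
    ; ∣-cong = ∣-cong
    ; ⁄-cong = ⁄-cong
    ; ∣-assoc = λ α β γ → ∼⇒het (∣-assoc α β γ)
    ; ∣-idˡ   = λ α → ∼⇒het (∣-idˡ α)
    ; ∣-idʳ   = λ α → ∼⇒het (∣-idʳ α)
    ; ⁄-assoc = λ α β γ → ∼⇒het (⁄-assoc α β γ)
    ; ⁄-idˡ   = λ α → ∼⇒het (⁄-idˡ α)
    ; ⁄-idʳ   = λ α → ∼⇒het (⁄-idʳ α)
    ; 1ₕ-∣ = 1ₕ-∣
    ; 1ᵥ-⁄ = 1ᵥ-⁄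
    ; 1ₕ≈1ᵥ = 1ₕ∼1ᵥ
    ; interchange = interchange
    }

open FreeCornering using (𝓒) public

{-# OPTIONS --safe #-}

-- Call a vertical edge X a companion of a horizontal edge A when cells
-- s : top A, right X and r : left X, bottom A satisfy s ∣ r = 1 and r ⁄ s = 1.
-- Two companions X, Y of the same A are isomorphic in 𝐇 through r ⁄ s.
-- Companions are closed under tensor (reversing the order on the horizontal
-- side) and under replacing A by a vertically isomorphic object, so with the
-- braiding A ° ⊗ B °, B ° ⊗ A ° and (A ⊗ B) ° are all companions of A ⊗ B.
-- The statements for • are those for ° in the horizontally reflected double
-- category.
module Submission where

open import Defs
open import Level using (Level; _⊔_)
open import Algebra.Structures using (IsMonoid)
open import Data.List using (_++_)
open import Data.Product using (_×_; _,_)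
open import Function using (flip)
open import Relation.Binary.PropositionalEquality using (_≡_; refl)
import Algebra.Construct.Flip.Op as Flip

-- Companions in an arbitrary single-object double category.

module Companions {h v c e} (𝔻 : SingleObjectDoubleCategory h v c e) where
  open SingleObjectDoubleCategory 𝔻
  open HorizontalCells 𝔻 hiding (𝐇)
  open StrictMonoidalCategory (𝐇 𝔻) using (_≅_)

  private
    module H = IsMonoid ⊗ₕ-isMonoid
    module V = IsMonoid ⊗ᵥ-isMonoid

    variable
      A B A′ B′ A″ B″ : Horizontal
      X Y X′ Y′ X″ Y″ : Vertical

    infixr 2 _≋⟨_⟩_ _≋⟨_⟨_
    infix  3 _∎

    _≋⟨_⟩_ : (α : Cell A B X Y) {β : Cell A′ B′ X′ Y′} {γ : Cell A″ B″ X″ Y″} →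
             α ≋ β → β ≋ γ → α ≋ γ
    _ ≋⟨ p ⟩ q = ≋-trans p q

    _≋⟨_⟨_ : (α : Cell A B X Y) {β : Cell A′ B′ X′ Y′} {γ : Cell A″ B″ X″ Y″} →
             β ≋ α → β ≋ γ → α ≋ γ
    _ ≋⟨ p ⟨ q = ≋-trans (≋-sym p) q

    _∎ : (α : Cell A B X Y) → α ≋ α
    _ ∎ = ≋-refl

  cast : A ≡ A′ → B ≡ B′ → X ≡ X′ → Y ≡ Y′ → Cell A B X Y → Cell A′ B′ X′ Y′
  cast refl refl refl refl α = α

  cast-≋ : (a : A ≡ A′) (b : B ≡ B′) (x : X ≡ X′) (y : Y ≡ Y′)
           (α : Cell A B X Y) → cast a b x y α ≋ α
  cast-≋ refl refl refl refl α = ≋-refl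

  ∣-identityˡ : (α : Cell A B Iᵥ Y) → 1ₕ Iₕ ∣ α ≋ α
  ∣-identityˡ α = ≋-trans (∣-cong≋ (het 1ₕ≈1ᵥ) ≋-refl) (∣-idˡ α)

  ∣-identityʳ : (α : Cell A B X Iᵥ) → α ∣ 1ₕ Iₕ ≋ α
  ∣-identityʳ α = ≋-trans (∣-cong≋ ≋-refl (het 1ₕ≈1ᵥ)) (∣-idʳ α)

  -- Only the trivial edge `Iᵥ` separates `α` and `β`, so either can come first: interchange turns
  -- both sides into `α ∣ β`, padded with vertical identities.
  slide : (α : Cell A A′ X Iᵥ) (β : Cell B B′ Iᵥ Y) →
          (α ∣ 1ₕ B) ⁄ (1ₕ A′ ∣ β) ≋ (1ₕ A ∣ β) ⁄ (α ∣ 1ₕ B′)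
  slide {A = A} {A′ = A′} {B = B} {B′ = B′} α β =
    (α ∣ 1ₕ B) ⁄ (1ₕ A′ ∣ β)  ≋⟨ het (interchange α (1ₕ A′) (1ₕ B) β) ⟨
    (α ⁄ 1ₕ A′) ∣ (1ₕ B ⁄ β)  ≋⟨ ∣-cong≋ (≋-trans (⁄-idʳ α) (≋-sym (⁄-idˡ α)))
                                        (≋-trans (⁄-idˡ β) (≋-sym (⁄-idʳ β))) ⟩
    (1ₕ A ⁄ α) ∣ (β ⁄ 1ₕ B′)  ≋⟨ het (interchange (1ₕ A) α β (1ₕ B′)) ⟩
    (1ₕ A ∣ β) ⁄ (α ∣ 1ₕ B′)  ∎

  ⁄-assoc-middle : (α : Cell A B X Y) (β : Cell B A′ X′ Y′)
                   (γ : Cell A′ B′ X″ Y″) {Z W : Vertical} (δ : Cell B′ A″ Z W) →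
                   (α ⁄ β) ⁄ (γ ⁄ δ) ≋ α ⁄ ((β ⁄ γ) ⁄ δ)
  ⁄-assoc-middle α β γ δ =
    (α ⁄ β) ⁄ (γ ⁄ δ)  ≋⟨ ⁄-assoc α β (γ ⁄ δ) ⟩
    α ⁄ (β ⁄ (γ ⁄ δ))  ≋⟨ ⁄-cong≋ ≋-refl (⁄-assoc β γ δ) ⟨
    α ⁄ ((β ⁄ γ) ⁄ δ)  ∎

  record Companion (X : Vertical) (A : Horizontal) : Set (c ⊔ e) where
    field
      s   : Cell A Iₕ Iᵥ X
      r   : Cell Iₕ A X Iᵥ
      s∣r : s ∣ r ≋ 1ₕ A
      r⁄s : r ⁄ s ≋ 1ᵥ X

  open Companion

  -- Padding with identities to (α ⁄ s ⁄ 1) ∣ (1 ⁄ r ⁄ β), interchange brings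
  -- s and r side by side.  The composites are only given up to ≋ so that their
  -- boundaries can be normalised.
  zigzag : (C : Companion X A) {α : Cell B A X′ Iᵥ} {β : Cell A B′ Iᵥ X″}
           {φ : Cell B Iₕ Y Y′} {ψ : Cell Iₕ B′ Y′ Y″} →
           φ ≋ α ⁄ s C → ψ ≋ r C ⁄ β → φ ∣ ψ ≋ α ⁄ β
  zigzag {A = A} C {α} {β} {φ} {ψ} p q =
    φ ∣ ψ
      ≋⟨ ∣-cong≋ (≋-trans p (⁄-cong≋ ≋-refl (≋-sym (⁄-idʳ (s C)))))
                 (≋-trans q (≋-sym (⁄-idˡ (r C ⁄ β)))) ⟩
    (α ⁄ (s C ⁄ 1ₕ Iₕ)) ∣ (1ₕ Iₕ ⁄ (r C ⁄ β))
      ≋⟨ het (interchange α (s C ⁄ 1ₕ Iₕ) (1ₕ Iₕ) (r C ⁄ β)) ⟩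
    (α ∣ 1ₕ Iₕ) ⁄ ((s C ⁄ 1ₕ Iₕ) ∣ (r C ⁄ β))
      ≋⟨ ⁄-cong≋ ≋-refl (het (interchange (s C) (1ₕ Iₕ) (r C) β)) ⟩
    (α ∣ 1ₕ Iₕ) ⁄ ((s C ∣ r C) ⁄ (1ₕ Iₕ ∣ β))
      ≋⟨ ⁄-cong≋ (∣-identityʳ α) (⁄-cong≋ (s∣r C) (∣-identityˡ β)) ⟩
    α ⁄ (1ₕ A ⁄ β)
      ≋⟨ ⁄-cong≋ ≋-refl (⁄-idˡ β) ⟩
    α ⁄ β ∎

  ≋-inverse⇒≅ : (f : HCell X Y) (g : HCell Y X) →
                f ∣ g ≋ 1ᵥ X → g ∣ f ≋ 1ᵥ Y → X ≅ Y
  ≋-inverse⇒≅ f g fg gf = record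
    { from = f
    ; to   = g
    ; from⨾to = ≋⇒≈ (≋-trans (⨾ₕ≋∣ f g) fg)
    ; to⨾from = ≋⇒≈ (≋-trans (⨾ₕ≋∣ g f) gf)
    }

  companion-unique : Companion X A → Companion Y A → X ≅ Y
  companion-unique {X = X} {A = A} {Y = Y} C D =
    ≋-inverse⇒≅ (compare C D) (compare D C) (inverse C D) (inverse D C)
    where
    compare : Companion X′ A → Companion Y′ A → HCell X′ Y′
    compare C D = cast refl refl (V.identityʳ _) (V.identityˡ _) (r C ⁄ s D)

    compare-≋ : (C : Companion X′ A) (D : Companion Y′ A) → compare C D ≋ r C ⁄ s D
    compare-≋ C D = cast-≋ refl refl (V.identityʳ _) (V.identityˡ _) (r C ⁄ s D)

    inverse : (C : Companion X′ A) (D : Companion Y′ A) →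
              compare C D ∣ compare D C ≋ 1ᵥ X′
    -- Composing `r C ⁄ s D` with `r D ⁄ s C` cancels `s D ∣ r D` in the middle and leaves
    -- `r C ⁄ s C`.
    inverse C D = ≋-trans (zigzag D (compare-≋ C D) (compare-≋ D C)) (r⁄s C)

  unit-companion : Companion Iᵥ Iₕ
  unit-companion = record
    { s   = 1ₕ Iₕ
    ; r   = 1ₕ Iₕ
    ; s∣r = ∣-identityˡ (1ₕ Iₕ)
    ; r⁄s = ≋-trans (⁄-idˡ (1ₕ Iₕ)) (het 1ₕ≈1ᵥ)
    }

  -- Take `ψ ⁄ s` and `r ⁄ φ`. Side by side, `zigzag` reduces them to `ψ ⁄ φ`; stacked, `φ ⁄ ψ`
  -- cancels between `r` and `s`.
  transport-companion : (φ : Cell A B Iᵥ Iᵥ) (ψ : Cell B A Iᵥ Iᵥ) →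
                        φ ⁄ ψ ≋ 1ₕ A → ψ ⁄ φ ≋ 1ₕ B →
                        Companion X A → Companion X B
  transport-companion {A = A} {X = X} φ ψ φψ ψφ C = record
    { s   = s′
    ; r   = r′
    ; s∣r = ≋-trans (zigzag C s′-≋ r′-≋) ψφ
    ; r⁄s =
        r′ ⁄ s′                  ≋⟨ ⁄-cong≋ r′-≋ s′-≋ ⟩
        (r C ⁄ φ) ⁄ (ψ ⁄ s C)    ≋⟨ ⁄-assoc-middle (r C) φ ψ (s C) ⟩
        r C ⁄ ((φ ⁄ ψ) ⁄ s C)    ≋⟨ ⁄-cong≋ ≋-refl (⁄-cong≋ φψ ≋-refl) ⟩
        r C ⁄ (1ₕ A ⁄ s C)       ≋⟨ ⁄-cong≋ ≋-refl (⁄-idˡ (s C)) ⟩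
        r C ⁄ s C                ≋⟨ r⁄s C ⟩
        1ᵥ X                     ∎
    }
    where
    s′ = cast refl refl (V.identityˡ Iᵥ) (V.identityˡ X) (ψ ⁄ s C)
    r′ = cast refl refl (V.identityʳ X) (V.identityˡ Iᵥ) (r C ⁄ φ)

    s′-≋ : s′ ≋ ψ ⁄ s C
    s′-≋ = cast-≋ refl refl (V.identityˡ Iᵥ) (V.identityˡ X) (ψ ⁄ s C)

    r′-≋ : r′ ≋ r C ⁄ φ
    r′-≋ = cast-≋ refl refl (V.identityʳ X) (V.identityˡ Iᵥ) (r C ⁄ φ)

  -- The order reverses because `s` sends edges out to the right: of `B ⊗ₕ A`, the factor `A` lies
  -- nearest that side and leaves first, so `X` comes above `Y`.
  tensor-companion : Companion X A → Companion Y B → Companion (X ⊗ᵥ Y) (B ⊗ₕ A)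
  tensor-companion {X = X} {A = A} {Y = Y} {B = B} C D = record
    { s   = s′
    ; r   = r′
    ; s∣r =
        s′ ∣ r′
          ≋⟨ ∣-cong≋ s′-≋ r′-≋ ⟩
        (sˣ ⁄ sʸ) ∣ (rˣ ⁄ rʸ)
          ≋⟨ het (interchange sˣ sʸ rˣ rʸ) ⟩
        (sˣ ∣ rˣ) ⁄ (sʸ ∣ rʸ)
          ≋⟨ ⁄-cong≋ upper lower ⟩
        1ₕ (B ⊗ₕ A) ⁄ 1ₕ (B ⊗ₕ A)
          ≋⟨ ⁄-idˡ (1ₕ (B ⊗ₕ A)) ⟩
        1ₕ (B ⊗ₕ A) ∎
    ; r⁄s =
        r′ ⁄ s′
          ≋⟨ ⁄-cong≋ r′-≋ s′-≋ ⟩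
        (rˣ ⁄ rʸ) ⁄ (sˣ ⁄ sʸ)
          ≋⟨ ⁄-assoc-middle rˣ rʸ sˣ sʸ ⟩
        rˣ ⁄ ((rʸ ⁄ sˣ) ⁄ sʸ)
          ≋⟨ ⁄-cong≋ (∣-idˡ (r C)) (⁄-cong≋ crossing (∣-idʳ (s D))) ⟩
        r C ⁄ ((s C ⁄ r D) ⁄ s D)
          ≋⟨ ⁄-assoc-middle (r C) (s C) (r D) (s D) ⟨
        (r C ⁄ s C) ⁄ (r D ⁄ s D)
          ≋⟨ ⁄-cong≋ (r⁄s C) (r⁄s D) ⟩
        1ᵥ X ⁄ 1ᵥ Y
          ≋⟨ het (1ᵥ-⁄ X Y) ⟩
        1ᵥ (X ⊗ᵥ Y) ∎
    }
    where
    sˣ = 1ₕ B ∣ s C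
    -- The padding with `1ᵥ` in `sʸ` and `rˣ` supplies a factor `Iₕ`, so that the edges at which the
    -- cells are stacked agree definitionally.
    sʸ = s D ∣ 1ᵥ Y
    rˣ = 1ᵥ X ∣ r C
    rʸ = r D ∣ 1ₕ A
    s′ = cast refl (H.identityˡ Iₕ) (V.identityˡ Iᵥ) refl (sˣ ⁄ sʸ)
    r′ = cast (H.identityˡ Iₕ) refl refl (V.identityˡ Iᵥ) (rˣ ⁄ rʸ)

    s′-≋ : s′ ≋ sˣ ⁄ sʸ
    s′-≋ = cast-≋ refl (H.identityˡ Iₕ) (V.identityˡ Iᵥ) refl (sˣ ⁄ sʸ)

    r′-≋ : r′ ≋ rˣ ⁄ rʸ
    r′-≋ = cast-≋ (H.identityˡ Iₕ) refl refl (V.identityˡ Iᵥ) (rˣ ⁄ rʸ)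

    upper : sˣ ∣ rˣ ≋ 1ₕ (B ⊗ₕ A)
    upper =
      (1ₕ B ∣ s C) ∣ rˣ   ≋⟨ ∣-assoc (1ₕ B) (s C) rˣ ⟩
      1ₕ B ∣ (s C ∣ rˣ)   ≋⟨ ∣-cong≋ ≋-refl (∣-cong≋ ≋-refl (∣-idˡ (r C))) ⟩
      1ₕ B ∣ (s C ∣ r C)  ≋⟨ ∣-cong≋ ≋-refl (s∣r C) ⟩
      1ₕ B ∣ 1ₕ A         ≋⟨ het (1ₕ-∣ B A) ⟩
      1ₕ (B ⊗ₕ A)         ∎

    lower : sʸ ∣ rʸ ≋ 1ₕ (B ⊗ₕ A)
    lower =
      sʸ ∣ (r D ∣ 1ₕ A)   ≋⟨ ∣-assoc sʸ (r D) (1ₕ A) ⟨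
      (sʸ ∣ r D) ∣ 1ₕ A   ≋⟨ ∣-cong≋ (∣-cong≋ (∣-idʳ (s D)) ≋-refl) ≋-refl ⟩
      (s D ∣ r D) ∣ 1ₕ A  ≋⟨ ∣-cong≋ (s∣r D) ≋-refl ⟩
      1ₕ B ∣ 1ₕ A         ≋⟨ het (1ₕ-∣ B A) ⟩
      1ₕ (B ⊗ₕ A)         ∎

    -- `B` enters from the left while `A` leaves on the right. Sliding these past each other puts
    -- `s C` directly below `r C` and `r D` directly above `s D`.
    crossing : rʸ ⁄ sˣ ≋ s C ⁄ r D
    crossing =
      (r D ∣ 1ₕ A) ⁄ (1ₕ B ∣ s C)    ≋⟨ slide (r D) (s C) ⟩
      (1ₕ Iₕ ∣ s C) ⁄ (r D ∣ 1ₕ Iₕ)  ≋⟨ ⁄-cong≋ (∣-identityˡ (s C)) (∣-identityʳ (r D)) ⟩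
      s C ⁄ r D                      ∎

-- Horizontal reflection of a double category.

module Reflection {h v c e} (𝔻 : SingleObjectDoubleCategory h v c e) where
  open SingleObjectDoubleCategory 𝔻
  open HorizontalCells 𝔻 hiding (𝐇)

  reflect-≋ : ∀ {A B X Y A′ B′ X′ Y′} {α : Cell A B X Y} {β : Cell A′ B′ X′ Y′} →
              α ≋ β → HetCell {Cell = λ A B X Y → Cell A B Y X} _≈_ α β
  reflect-≋ (het p) = het p

  unreflect-≋ : ∀ {A B X Y A′ B′ X′ Y′} {α : Cell A B X Y} {β : Cell A′ B′ X′ Y′} →
                HetCell {Cell = λ A B X Y → Cell A B Y X} _≈_ α β → α ≋ β
  unreflect-≋ (het p) = het p

  reflection : SingleObjectDoubleCategory h v c e
  reflection = record
    { Horizontal  = Horizontal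
    ; _⊗ₕ_        = flip _⊗ₕ_
    ; Iₕ          = Iₕ
    ; ⊗ₕ-isMonoid = Flip.isMonoid ⊗ₕ-isMonoid
    ; Vertical    = Vertical
    ; _⊗ᵥ_        = _⊗ᵥ_
    ; Iᵥ          = Iᵥ
    ; ⊗ᵥ-isMonoid = ⊗ᵥ-isMonoid
    ; Cell = λ A B X Y → Cell A B Y X
    ; _≈_  = _≈_
    ; ≈-isEquivalence = ≈-isEquivalence
    ; _∣_ = λ α β → β ∣ α
    ; _⁄_ = _⁄_
    ; 1ₕ  = 1ₕ
    ; 1ᵥ  = 1ᵥ
    ; ∣-cong = λ p q → ∣-cong q p
    ; ⁄-cong = ⁄-cong
    ; ∣-assoc = λ α β γ → reflect-≋ (≋-sym (∣-assoc γ β α))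
    ; ∣-idˡ   = λ α → reflect-≋ (∣-idʳ α)
    ; ∣-idʳ   = λ α → reflect-≋ (∣-idˡ α)
    ; ⁄-assoc = λ α β γ → reflect-≋ (⁄-assoc α β γ)
    ; ⁄-idˡ   = λ α → reflect-≋ (⁄-idˡ α)
    ; ⁄-idʳ   = λ α → reflect-≋ (⁄-idʳ α)
    ; 1ₕ-∣ = λ A B → 1ₕ-∣ B A
    ; 1ᵥ-⁄ = 1ᵥ-⁄
    ; 1ₕ≈1ᵥ = 1ₕ≈1ᵥ
    ; interchange = λ α β γ δ → interchange γ δ α β
    }

  -- Reflection reverses the arrows of `𝐇` and keeps its objects, so `from` and `to` trade places.
  -- The passage through `∣` avoids comparing the two `subst₂` transports inside `⨾ₕ`.
  unreflect-≅ : ∀ {X Y} → StrictMonoidalCategory._≅_ (𝐇 reflection) X Y →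
                StrictMonoidalCategory._≅_ (𝐇 𝔻) X Y
  unreflect-≅ i = Companions.≋-inverse⇒≅ 𝔻 to from
    (unreflect-≋ (R.≋-trans (R.≋-sym (R.⨾ₕ≋∣ from to)) (het from⨾to)))
    (unreflect-≋ (R.≋-trans (R.≋-sym (R.⨾ₕ≋∣ to from)) (het to⨾from)))
    where
    open StrictMonoidalCategory._≅_ i
    module R = HorizontalCells reflection

-- Corners of the free cornering as companions.

module CornerCompanions {o ℓ e} (𝔸 : SymmetricStrictMonoidalCategory o ℓ e) where
  open FreeCornering 𝔸 hiding (𝓒)
  open Reflection (𝓒 𝔸)
  private module A = SymmetricStrictMonoidalCategory 𝔸
  module C = Companions (𝓒 𝔸)
  module K = Companions reflection

  °-companion : ∀ A → C.Companion (A °) A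
  °-companion A = record
    { s   = s° A
    ; r   = r° A
    ; s∣r = ∼⇒het (yank°-∣ A)
    ; r⁄s = ∼⇒het (yank°-⁄ A)
    }

  •-companion : ∀ A → K.Companion (A •) A
  •-companion A = record
    { s   = s• A
    ; r   = r• A
    ; s∣r = reflect-≋ (∼⇒het (yank•-∣ A))
    ; r⁄s = reflect-≋ (∼⇒het (yank•-⁄ A))
    }

  σ-cancel : ∀ A B → ⌜ A.σ A B ⌝ ⁄ ⌜ A.σ B A ⌝ ∼ 1ₕ (A A.⊗ B)
  σ-cancel A B = ∼-trans (⌜⌝-⨾ (A.σ A B) (A.σ B A))
    (∼-trans (⌜⌝-cong (A.σ-involutive A B)) (⌜⌝-id (A A.⊗ B)))

  -- The braiding undoes the reversal `B ⊗ A` produced by `tensor-companion`.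
  °-tensor : ∀ A B → C.Companion (A ° ++ B °) (A A.⊗ B)
  °-tensor A B = C.transport-companion ⌜ A.σ B A ⌝ ⌜ A.σ A B ⌝
    (het (σ-cancel B A)) (het (σ-cancel A B))
    (C.tensor-companion (°-companion A) (°-companion B))

  -- In the reflection `⊗ₕ` is flipped, so `tensor-companion` already lands on `A ⊗ B`; here the
  -- braiding gives the opposite order, for the commutation of `A •` with `B •`.
  •-tensor : ∀ A B → K.Companion (A • ++ B •) (B A.⊗ A)
  •-tensor A B = K.transport-companion ⌜ A.σ A B ⌝ ⌜ A.σ B A ⌝
    (het (σ-cancel A B)) (het (σ-cancel B A))
    (K.tensor-companion (•-companion A) (•-companion B))

lemma6p3 : ∀ {o ℓ e : Level} (𝔸 : SymmetricStrictMonoidalCategory o ℓ e) →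
    let module 𝔸 = SymmetricStrictMonoidalCategory 𝔸
        open StrictMonoidalCategory (𝐇 (𝓒 𝔸))
        open FreeCornering 𝔸
    in (A B : 𝔸.Obj) →
       ((𝔸.unit ° ≅ unit) × (unit ≅ 𝔸.unit •))
     × ((A ° ⊗ B ° ≅ B ° ⊗ A °) × (A • ⊗ B • ≅ B • ⊗ A •))
     × (((A 𝔸.⊗ B) ° ≅ A ° ⊗ B °) × ((A 𝔸.⊗ B) • ≅ A • ⊗ B •))
lemma6p3 𝔸 A B =
    ( C.companion-unique (°-companion A.unit) C.unit-companion
    , unreflect-≅ (K.companion-unique K.unit-companion (•-companion A.unit)) )
  -- In each pair both words are companions of `A ⊗ B`, one of them by way of the braiding.
  , ( C.companion-unique (°-tensor A B)
        (C.tensor-companion (°-companion B) (°-companion A))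
    , unreflect-≅ (K.companion-unique
        (K.tensor-companion (•-companion A) (•-companion B)) (•-tensor B A)) )
  , ( C.companion-unique (°-companion (A A.⊗ B)) (°-tensor A B)
    , unreflect-≅ (K.companion-unique (•-companion (A A.⊗ B))
        (K.tensor-companion (•-companion A) (•-companion B))) )
  where
  module A = SymmetricStrictMonoidalCategory 𝔸
  open CornerCompanions 𝔸
  open Reflection (𝓒 𝔸) using (unreflect-≅)
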